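{- Let $\Gamma=(V,E)$ be a point-transitive, reflexive, locally finite relation and let $v\in V$. Let $F\subset V$ satisfy $F\cap\Gamma^-(v)=\{v\}$. (i) If $F$ is finite, then $|\Gamma(F)\setminus F|\ge|\Gamma(v)|-1$. (ii) If $F$ is cofinite (i.e. $V\setminus F$ is finite), then $|\Gamma(F)\setminus F|\ge|\Gamma^-(v)|-1$.
   Context: A relation is a pair $\Gamma=(V,E)$ with $E\subset V\times V$; for $X\subset V$, $\Gamma(X)=\{y: (x,y)\in E \text{ for some } x\in X\}$, $\Gamma^-(X)=\{y:(y,x)\in E\text{ for some }x\in X\}$, $\Gamma(x)=\Gamma(\{x\})$. $\Gamma$ is reflexive if $(x,x)\in E$ for all $x$, and locally finite if $\Gamma(x)$ and $\Gamma^-(x)$ are finite for all $x$. An automorphism is a bijection $f:V\to V$ with $\Gamma(f(x))=f(\Gamma(x))$ for all $x$; $\Gamma$ is point-transitive if for all $x,y\in V$ there is an automorphism $f$ with $f(x)=y$. -}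

module Defs where

open import Data.List.Base using (List; []; _∷_; length; map; concat)
open import Data.List.Membership.Propositional using () renaming (_∈_ to _∈ˡ_)
open import Data.List.Membership.Propositional.Properties using (∈-concat⁺′; ∈-map⁺)
open import Data.List.Relation.Unary.All.Properties using (¬Any⇒All¬)
open import Data.List.Relation.Unary.AllPairs using ([]; _∷_)
open import Data.List.Relation.Unary.Any using (here; there)
open import Data.List.Relation.Unary.Unique.Propositional using (Unique)
open import Data.Nat.Base using (ℕ)
open import Data.Product using (∃-syntax; _×_; _,_; proj₁)
open import Function.Base using (_∘_)
open import Function.Bundles using (_⇔_; mk⇔; module Equivalence)
open import Function.Definitions using (Bijective)
open import Level using (Level; _⊔_)
open import Relation.Binary.Core using (Rel)
open import Relation.Binary.PropositionalEquality using (_≡_; refl; subst; sym)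
open import Relation.Nullary using (Dec; ¬_; yes; no; contradiction)
open import Relation.Nullary.Decidable.Core using (¬¬-excluded-middle)
open import Relation.Unary using (Pred; _∈_; _∖_; _≐_; ∁; ｛_｝)

private
  variable
    a ℓ p : Level

infix 4 ∣_∣≡_

-- Cardinality is a relation because a predicate need not be decidable; the
-- listing is duplicate-free, so n is uniquely determined by S.
∣_∣≡_ : {V : Set a} → Pred V p → ℕ → Set (a ⊔ p)
∣_∣≡_ {V = V} S n = ∃[ xs ] length xs ≡ n × Unique xs × (∀ (x : V) → x ∈ S ⇔ x ∈ˡ xs)

Finite : {V : Set a} → Pred V p → Set (a ⊔ p)
Finite S = ∃[ n ] ∣ S ∣≡ n

Cofinite : {V : Set a} → Pred V p → Set (a ⊔ p)
Cofinite S = Finite (∁ S)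

-- A relation Γ = (V , E) is given by its edge relation, which is itself
-- called Γ: `Γ x y` means (x , y) ∈ E.  The images Γ(X), Γ⁻(X), Γ(x), Γ⁻(x)
-- are Γ ⟨ X ⟩, Γ ⁻⟨ X ⟩, Γ [ x ], Γ ⁻[ x ].

infix 9 _⟨_⟩ _⁻⟨_⟩ _[_] _⁻[_]

_⟨_⟩ : {V : Set a} → Rel V ℓ → Pred V p → Pred V (a ⊔ ℓ ⊔ p)
(Γ ⟨ X ⟩) y = ∃[ x ] x ∈ X × Γ x y

_⁻⟨_⟩ : {V : Set a} → Rel V ℓ → Pred V p → Pred V (a ⊔ ℓ ⊔ p)
(Γ ⁻⟨ X ⟩) y = ∃[ x ] x ∈ X × Γ y x

_[_] : {V : Set a} → Rel V ℓ → V → Pred V (a ⊔ ℓ)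
Γ [ x ] = Γ ⟨ ｛ x ｝ ⟩

_⁻[_] : {V : Set a} → Rel V ℓ → V → Pred V (a ⊔ ℓ)
Γ ⁻[ x ] = Γ ⁻⟨ ｛ x ｝ ⟩

Image : {V : Set a} → (V → V) → Pred V p → Pred V (a ⊔ p)
Image f X y = ∃[ x ] x ∈ X × f x ≡ y

LocallyFinite : {V : Set a} → Rel V ℓ → Set (a ⊔ ℓ)
LocallyFinite Γ = ∀ x → Finite (Γ [ x ]) × Finite (Γ ⁻[ x ])

IsAutomorphism : {V : Set a} → Rel V ℓ → (V → V) → Set (a ⊔ ℓ)
IsAutomorphism Γ f = Bijective _≡_ _≡_ f × (∀ x → Γ [ f x ] ≐ Image f (Γ [ x ]))

PointTransitive : {V : Set a} → Rel V ℓ → Set (a ⊔ ℓ)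
PointTransitive Γ = ∀ x y → ∃[ f ] IsAutomorphism Γ f × f x ≡ y

-- Γ(F) ∖ F is (classically) finite for F finite or cofinite, so a statement
-- quantified over all n with ∣ Γ ⟨ F ⟩ ∖ F ∣≡ n is not vacuous.  Without
-- decidability assumptions this finiteness holds only up to double negation.

covered⇒¬¬finite : {V : Set a} (xs : List V) (S : Pred V p) →
                   (∀ x → x ∈ S → x ∈ˡ xs) → ¬ ¬ Finite S
covered⇒¬¬finite []       S cov ¬fin =
  ¬fin (0 , [] , refl , [] , λ x → mk⇔ (cov x) λ ())
covered⇒¬¬finite (y ∷ xs) S cov ¬fin =
  covered⇒¬¬finite xs (S ∖ ｛ y ｝) cov′ λ where
    (n , zs , _ , uniq , eq) → ¬¬-excluded-middle λ where
      (no y∉S) → ¬fin (length zs , zs , refl , uniq , λ x → mk⇔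
        (λ x∈S → Equivalence.to (eq x) (x∈S , λ y≡x → y∉S (subst S (sym y≡x) x∈S)))
        (proj₁ ∘ Equivalence.from (eq x)))
      (yes y∈S) →
        let y∉zs : ¬ (y ∈ˡ zs)
            y∉zs y∈zs = let (_ , y≢y) = Equivalence.from (eq y) y∈zs in y≢y refl
        in dec-on (y ∷ xs) λ dec → ¬fin
          ( length (y ∷ zs) , y ∷ zs , refl , ¬Any⇒All¬ zs y∉zs ∷ uniq , λ x → mk⇔
            (λ x∈S → case-dec (dec x (cov x x∈S))
              (λ { refl → here refl })
              (λ y≢x → there (Equivalence.to (eq x) (x∈S , y≢x))))
            λ { (here refl) → y∈S ; (there x∈zs) → proj₁ (Equivalence.from (eq x) x∈zs) } )
  where
  case-dec : ∀ {b c} {B : Set b} {C : Set c} → Dec B → (B → C) → (¬ B → C) → C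
  case-dec (yes q) f g = f q
  case-dec (no ¬q) f g = g ¬q

  cov′ : ∀ x → x ∈ (S ∖ ｛ y ｝) → x ∈ˡ xs
  cov′ x (x∈S , y≢x) with cov x x∈S
  ... | here x≡y   = contradiction (sym x≡y) y≢x
  ... | there x∈xs = x∈xs

  dec-on : ∀ ws → ¬ ¬ (∀ x → x ∈ˡ ws → Dec (y ≡ x))
  dec-on []       k = k λ x ()
  dec-on (w ∷ ws) k = dec-on ws λ rest → ¬¬-excluded-middle λ d →
    k λ { x (here refl) → d ; x (there x∈ws) → rest x x∈ws }

finite⇒¬¬finite-boundary : {V : Set a} (Γ : Rel V ℓ) → LocallyFinite Γ →
                           (F : Pred V p) → Finite F → ¬ ¬ Finite (Γ ⟨ F ⟩ ∖ F)
finite⇒¬¬finite-boundary {V = V} Γ lf F (_ , xs , _ , _ , eq) =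
  covered⇒¬¬finite (concat (map nbrs xs)) (Γ ⟨ F ⟩ ∖ F) λ where
    y ((x , x∈F , xy) , _) →
      ∈-concat⁺′ (nbrs-complete x y xy) (∈-map⁺ nbrs (Equivalence.to (eq x) x∈F))
  where
  nbrs : V → List V
  nbrs x = let ((_ , ys , _) , _) = lf x in ys

  nbrs-complete : ∀ x y → Γ x y → y ∈ˡ nbrs x
  nbrs-complete x y xy =
    let ((_ , _ , _ , _ , eqx) , _) = lf x in Equivalence.to (eqx y) (x , refl , xy)

cofinite⇒¬¬finite-boundary : {V : Set a} (Γ : Rel V ℓ) (F : Pred V p) →
                             Cofinite F → ¬ ¬ Finite (Γ ⟨ F ⟩ ∖ F)
cofinite⇒¬¬finite-boundary Γ F (_ , xs , _ , _ , eq) =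
  covered⇒¬¬finite xs (Γ ⟨ F ⟩ ∖ F) λ { y (_ , y∉F) → Equivalence.to (eq y) y∉F }

{-# OPTIONS --safe #-}

-- Write ∂X = Γ(X) ∖ X.  Among the finite nonempty sets take those minimising
-- ∣∂X∣ and, among these, one of least size: an atom.  Submodularity of ∣∂∣ shows
-- that two atoms which meet are equal, so by transitivity there is an atom A ∋ v
-- on which the automorphisms stabilising A act transitively; submodularity also
-- gives ∣∂(F ∩ A)∣ ≤ ∣∂F∣.  Vertices of Γ(v) ∖ A lie in ∂(F ∩ A), so it remains
-- to prove (i) for the finite relation induced on A.  There F ∩ A and Γ(v) ∩ A
-- are lifted to the automorphism group of the induced relation, and the claim
-- becomes the theorem of Scherk and Kemperman: if ab = 1 with a ∈ A, b ∈ B only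
-- for a = b = 1, then ∣AB∣ ≥ ∣A∣ + ∣B∣ − 1.
-- Part (ii) is part (i) for the reversed relation and {v} ∪ (V ∖ Γ(F)).
--
-- Since V has no decidable equality, finite sets obtained by comprehension exist
-- only up to double negation; this suffices because ≤ on ℕ is stable.

module Submission where

open import Defs
open import Algebra.Bundles using (Group)
import Algebra.Properties.Group as GroupProperties
open import Algebra.Structures using (IsGroup)
open import Data.Empty using (⊥-elim)
open import Data.Fin.Base using (Fin; zero; suc)
import Data.Fin.Properties as Fin
open import Data.List.Base as List using (List; []; _∷_; _++_; length; map; allFin; cartesianProduct; cartesianProductWith; concatMap)
open import Data.List.Membership.Propositional using (_∈_; _∉_; find; lose)
open import Data.List.Membership.Propositional.Properties using (∈-++⁺ˡ; ∈-++⁺ʳ; ∈-++⁻; ∈-∃++; ∈-map⁺; ∈-map⁻; ∈-length; ∈-lookup; ∈-allFin; ∈-cartesianProduct⁺; ∈-cartesianProductWith⁺; ∈-concatMap⁺; ∈-concatMap⁻)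
open import Data.List.Properties using (length-++; length-++-sucʳ; length-map)
open import Data.List.Relation.Unary.All as All using ()
open import Data.List.Relation.Unary.All.Properties using (¬Any⇒All¬)
open import Data.List.Relation.Unary.AllPairs using ([]; _∷_)
open import Data.List.Relation.Unary.Any as Any using (here; there)
open import Data.List.Relation.Unary.Any.Properties using (lookup-index)
open import Data.List.Relation.Unary.Unique.Propositional using (Unique)
open import Data.List.Relation.Unary.Unique.Propositional.Properties using (map⁺; ++⁺)
open import Data.Nat.Base using (ℕ; zero; suc; _+_; _*_; _∸_; _≤_; _<_; _≥_; z≤n; s≤s; s≤s⁻¹; >-nonZero)
open import Data.Nat.Induction using (<-rec)
open import Data.Nat.Properties
open import Algebra.Properties.CommutativeSemigroup +-commutativeSemigroup using () renaming (interchange to +-interchange)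
open import Data.Product as Product using (∃-syntax; _×_; _,_; proj₁; proj₂; swap)
open import Data.Sum as Sum using (_⊎_; inj₁; inj₂; [_,_]′; map₁; map₂)
open import Data.Vec.Base as Vec using (Vec; []; _∷_)
import Data.Vec.Properties as Vec
open import Function.Base using (_∘_; id; flip; case_of_)
open import Function.Bundles using (_⇔_; mk⇔; module Equivalence)
open import Level using (Level; _⊔_)
open import Relation.Binary.Core using (Rel)
open import Relation.Binary.Definitions using (Reflexive)
open import Relation.Binary.PropositionalEquality using (_≡_; _≢_; refl; sym; trans; cong; cong₂; subst; subst₂; isEquivalence; module ≡-Reasoning)
open import Relation.Nullary using (Dec; yes; no; ¬_; contradiction)
open import Relation.Nullary.Decidable using (decidable-stable; _×-dec_; ¬¬-excluded-middle)
open import Relation.Unary using (Pred; _∩_; _∖_; _≐_; ｛_｝)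

private
  variable
    a b ℓ p : Level
    A : Set a
    B : Set b

-- The double-negation monad.

pure : A → ¬ ¬ A
pure x k = k x

_>>=_ : ¬ ¬ A → (A → ¬ ¬ B) → ¬ ¬ B
(m >>= f) k = m λ x → f x k

≤-stable : ∀ {m n} → ¬ ¬ (m ≤ n) → m ≤ n
≤-stable = decidable-stable (_ ≤? _)

-- Double negation commutes constructively with finite conjunctions, though not with arbitrary
-- universal quantification; hence the restriction to members of a list.
¬¬-∀∈ : {P : A → Set p} (xs : List A) → (∀ {x} → x ∈ xs → ¬ ¬ P x) → ¬ ¬ (∀ {x} → x ∈ xs → P x)
¬¬-∀∈ []       h = pure λ ()
¬¬-∀∈ (x ∷ xs) h = do
  Px  ← h (here refl)
  Pxs ← ¬¬-∀∈ xs (h ∘ there)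
  pure λ { (here refl) → Px ; (there x∈xs) → Pxs x∈xs }

-- Counting with duplicate-free lists.

module _ {A : Set a} where

  private
    variable
      x : A
      xs ys s₁ s₂ t₁ t₂ : List A

  ∈-remove : ∀ {y} ys {zs} → y ∈ ys ++ x ∷ zs → y ≡ x ⊎ y ∈ ys ++ zs
  ∈-remove ys y∈ with ∈-++⁻ ys y∈
  ... | inj₁ y∈ys         = inj₂ (∈-++⁺ˡ y∈ys)
  ... | inj₂ (here y≡x)   = inj₁ y≡x
  ... | inj₂ (there y∈zs) = inj₂ (∈-++⁺ʳ ys y∈zs)

  head∉ : Unique (x ∷ xs) → x ∉ xs
  head∉ (x≢xs ∷ _) x∈xs = All.lookup x≢xs x∈xs refl

  unique-∷ : x ∉ xs → Unique xs → Unique (x ∷ xs)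
  unique-∷ x∉xs u = ¬Any⇒All¬ _ x∉xs ∷ u

  ∈-remove-≢ : ∀ {y} ys {zs} → y ≢ x → y ∈ ys ++ x ∷ zs → y ∈ ys ++ zs
  ∈-remove-≢ ys y≢x = [ (λ y≡x → contradiction y≡x y≢x) , id ]′ ∘ ∈-remove ys

  tail≢head : ∀ {y} → Unique (x ∷ xs) → y ∈ xs → y ≢ x
  tail≢head u y∈xs refl = head∉ u y∈xs

  length-mono : Unique xs → (∀ {y} → y ∈ xs → y ∈ ys) → length xs ≤ length ys
  length-mono []         xs⊆ys = z≤n
  length-mono u@(_ ∷ u′) xs⊆ys with ∈-∃++ (xs⊆ys (here refl))
  ... | ps , qs , refl = subst (_ ≤_) (sym (length-++-sucʳ ps _ qs))
    (s≤s (length-mono u′ λ y∈xs → ∈-remove-≢ ps (tail≢head u y∈xs) (xs⊆ys (there y∈xs))))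

  -- By induction on `s₁`: its head is struck from the list among `t₁`, `t₂` in which it is found.
  -- If `s₂` also contains this head, the last hypothesis puts it in the other list, so the
  -- hypothesis on `s₂` survives.
  length-submodular : Unique s₁ → Unique s₂ →
    (∀ {y} → y ∈ s₁ → y ∈ t₁ ⊎ y ∈ t₂) → (∀ {y} → y ∈ s₂ → y ∈ t₁ ⊎ y ∈ t₂) →
    (∀ {y} → y ∈ s₁ → y ∈ s₂ → y ∈ t₁ × y ∈ t₂) →
    length s₁ + length s₂ ≤ length t₁ + length t₂
  length-submodular {t₁ = t₁} [] u₂ _ h₂ _ =
    subst (_ ≤_) (length-++ t₁) (length-mono u₂ ([ ∈-++⁺ˡ , ∈-++⁺ʳ t₁ ]′ ∘ h₂))
  length-submodular {s₁ = x ∷ s₁} {s₂ = s₂} {t₁ = t₁} {t₂ = t₂} u@(_ ∷ u₁) u₂ h₁ h₂ h₁₂ with h₁ (here refl)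
  ... | inj₁ x∈t₁ with ps , qs , refl ← ∈-∃++ x∈t₁ =
    subst (λ k → _ ≤ k + length t₂) (sym (length-++-sucʳ ps _ qs)) (s≤s (length-submodular u₁ u₂
      (λ y∈s₁ → map₁ (∈-remove-≢ ps (tail≢head u y∈s₁)) (h₁ (there y∈s₁)))
      (λ y∈s₂ → [ [ (λ { refl → inj₂ (proj₂ (h₁₂ (here refl) y∈s₂)) }) , inj₁ ]′ ∘ ∈-remove ps , inj₂ ]′ (h₂ y∈s₂))
      (λ y∈s₁ y∈s₂ → Product.map₁ (∈-remove-≢ ps (tail≢head u y∈s₁)) (h₁₂ (there y∈s₁) y∈s₂))))
  ... | inj₂ x∈t₂ with ps , qs , refl ← ∈-∃++ x∈t₂ =
    subst (length (x ∷ s₁) + length s₂ ≤_) (sym (trans (cong (length t₁ +_) (length-++-sucʳ ps _ qs)) (+-suc (length t₁) _)))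
    (s≤s (length-submodular u₁ u₂
      (λ y∈s₁ → map₂ (∈-remove-≢ ps (tail≢head u y∈s₁)) (h₁ (there y∈s₁)))
      (λ y∈s₂ → [ inj₁ , [ (λ { refl → inj₁ (proj₁ (h₁₂ (here refl) y∈s₂)) }) , inj₂ ]′ ∘ ∈-remove ps ]′ (h₂ y∈s₂))
      (λ y∈s₁ y∈s₂ → Product.map₂ (∈-remove-≢ ps (tail≢head u y∈s₁)) (h₁₂ (there y∈s₁) y∈s₂))))

  length-mono-¬¬ : Unique xs → (∀ {y} → y ∈ xs → ¬ ¬ (y ∈ ys)) → length xs ≤ length ys
  length-mono-¬¬ {xs = xs} u h = ≤-stable do
    xs⊆ys ← ¬¬-∀∈ xs h
    pure (length-mono u xs⊆ys)

  length-submodular-¬¬ : Unique s₁ → Unique s₂ →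
    (∀ {y} → y ∈ s₁ → ¬ ¬ (y ∈ t₁ ⊎ y ∈ t₂)) → (∀ {y} → y ∈ s₂ → ¬ ¬ (y ∈ t₁ ⊎ y ∈ t₂)) →
    (∀ {y} → y ∈ s₁ → y ∈ s₂ → ¬ ¬ (y ∈ t₁ × y ∈ t₂)) →
    length s₁ + length s₂ ≤ length t₁ + length t₂
  length-submodular-¬¬ {s₁ = s₁} {s₂ = s₂} u₁ u₂ h₁ h₂ h₁₂ = ≤-stable do
    k₁  ← ¬¬-∀∈ s₁ h₁
    k₂  ← ¬¬-∀∈ s₂ h₂
    k₁₂ ← ¬¬-∀∈ s₁ λ y∈s₁ → stable-∀ (h₁₂ y∈s₁)
    pure (length-submodular u₁ u₂ k₁ k₂ k₁₂)
    where
    stable-∀ : ∀ {y : A} {P : Set a} → (y ∈ s₂ → ¬ ¬ P) → ¬ ¬ (y ∈ s₂ → P)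
    stable-∀ h k = k λ y∈s₂ → ⊥-elim (h y∈s₂ λ Py → k λ _ → Py)

  ⊆∧length≥⇒⊇ : Unique xs → (∀ {y} → y ∈ xs → ¬ ¬ (y ∈ ys)) → length ys ≤ length xs →
    ∀ {y} → y ∈ ys → ¬ ¬ (y ∈ xs)
  ⊆∧length≥⇒⊇ u xs⊆ys ys≤xs y∈ys y∉xs =
    <⇒≱ (length-mono-¬¬ (unique-∷ y∉xs u) λ { (here refl) → pure y∈ys ; (there z∈xs) → xs⊆ys z∈xs }) ys≤xs

-- The theorem of Scherk and Kemperman

module _ {G : Set a} {_∙_ : G → G → G} {ε : G} {_⁻¹ : G → G} (isGroup : IsGroup _≡_ _∙_ ε _⁻¹) where

  open IsGroup isGroup using (assoc; identityˡ; identityʳ)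

  private
    group : Group a a
    group = record { isGroup = isGroup }

  open GroupProperties group using (∙-cancelˡ; ∙-cancelʳ)

  -- The list `cs` only has to contain the products, so it can stay fixed while `as` and `bs`
  -- change. In `only-ε`, `y ≡ ε` follows from `x ≡ ε`.
  record UniquelyFactored (cs as bs : List G) : Set a where
    field
      unique-as : Unique as
      unique-bs : Unique bs
      ε∈as      : ε ∈ as
      ε∈bs      : ε ∈ bs
      as∙bs⊆cs  : ∀ {x y} → x ∈ as → y ∈ bs → (x ∙ y) ∈ cs
      only-ε    : ∀ {x y} → x ∈ as → y ∈ bs → (x ∙ y) ≡ ε → x ≡ ε

    as⊆cs : ∀ {x} → x ∈ as → x ∈ cs
    as⊆cs x∈as = subst (_∈ cs) (identityʳ _) (as∙bs⊆cs x∈as ε∈bs)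

    bs⊆cs : ∀ {x} → x ∈ bs → x ∈ cs
    bs⊆cs x∈bs = subst (_∈ cs) (identityˡ _) (as∙bs⊆cs ε∈as x∈bs)

  -- A lexicographic increase, of the total length first and of `as` second. Both are bounded
  -- because `as` and `bs` embed in `cs`, so such changes come to an end.
  Progress : (as bs as′ bs′ : List G) → Set
  Progress as bs as′ bs′ =
    (length as + length bs ≤ length as′ + length bs′ × length as < length as′)
    ⊎ length as + length bs < length as′ + length bs′

  -- For ε ≢ g ∈ A ∩ B the pairs (A ∪ Ag , B ∩ g⁻¹B) and (A ∩ Ag⁻¹ , B ∪ gB) have
  -- their products inside AB, and on average they are as large as (A , B).
  transform : ∀ {cs as bs g} → UniquelyFactored cs as bs → g ∈ as → g ∈ bs → g ≢ ε →
    ¬ ¬ (∃[ as′ ] ∃[ bs′ ] UniquelyFactored cs as′ bs′ × Progress as bs as′ bs′)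
  transform {cs} {as} {bs} {g} U g∈as g∈bs g≢ε = do
    (_ , as₁ , _ , uas₁ , as₁⇔) ← covered⇒¬¬finite (as ++ map (_∙ g) as) (λ x → x ∈ as ⊎ x ∈ map (_∙ g) as)
      (λ _ → [ ∈-++⁺ˡ , ∈-++⁺ʳ as ]′)
    (_ , bs₁ , _ , ubs₁ , bs₁⇔) ← covered⇒¬¬finite bs (λ x → x ∈ bs × (g ∙ x) ∈ bs) (λ _ → proj₁)
    (_ , as₂ , _ , uas₂ , as₂⇔) ← covered⇒¬¬finite as (λ x → x ∈ as × (x ∙ g) ∈ as) (λ _ → proj₁)
    (_ , bs₂ , _ , ubs₂ , bs₂⇔) ← covered⇒¬¬finite (bs ++ map (g ∙_) bs) (λ x → x ∈ bs ⊎ x ∈ map (g ∙_) bs)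
      (λ _ → [ ∈-++⁺ˡ , ∈-++⁺ʳ bs ]′)
    let
      as₁⁻ = λ {x} → from (as₁⇔ x)
      bs₁⁻ = λ {x} → from (bs₁⇔ x)
      as₂⁻ = λ {x} → from (as₂⇔ x)
      bs₂⁻ = λ {x} → from (bs₂⇔ x)

      U₁ : UniquelyFactored cs as₁ bs₁
      U₁ = record
        { unique-as = uas₁ ; unique-bs = ubs₁
        ; ε∈as = to (as₁⇔ ε) (inj₁ ε∈as)
        ; ε∈bs = to (bs₁⇔ ε) (ε∈bs , subst (_∈ bs) (sym (identityʳ g)) g∈bs)
        ; as∙bs⊆cs = λ x∈ y∈ → product₁ (as₁⁻ x∈) (bs₁⁻ y∈)
        ; only-ε = λ x∈ y∈ → only-ε₁ (as₁⁻ x∈) (bs₁⁻ y∈)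
        }

      U₂ : UniquelyFactored cs as₂ bs₂
      U₂ = record
        { unique-as = uas₂ ; unique-bs = ubs₂
        ; ε∈as = to (as₂⇔ ε) (ε∈as , subst (_∈ as) (sym (identityˡ g)) g∈as)
        ; ε∈bs = to (bs₂⇔ ε) (inj₁ ε∈bs)
        ; as∙bs⊆cs = λ x∈ y∈ → product₂ (as₂⁻ x∈) (bs₂⁻ y∈)
        ; only-ε = λ x∈ y∈ → only-ε₂ (as₂⁻ x∈) (bs₂⁻ y∈)
        }

      -- `map (_∙ g) as₂` is the intersection of `as` and `map (_∙ g) as`, while `as₁` is their
      -- union.
      as-size : length as + length as ≤ length as₁ + length as₂
      as-size = begin
        length as + length as                      ≡⟨ cong (length as +_) (length-map (_∙ g) as) ⟨
        length as + length (map (_∙ g) as)         ≤⟨ length-submodular unique-as (map⁺ (∙-cancelʳ g _ _) unique-as)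
          (λ y∈ → inj₁ (to (as₁⇔ _) (inj₁ y∈)))
          (λ y∈ → inj₁ (to (as₁⇔ _) (inj₂ y∈)))
          (λ y∈ y∈g → to (as₁⇔ _) (inj₁ y∈) , in-as₂ as₂⇔ y∈ (∈-map⁻ _ y∈g)) ⟩
        length as₁ + length (map (_∙ g) as₂)       ≡⟨ cong (length as₁ +_) (length-map (_∙ g) as₂) ⟩
        length as₁ + length as₂                    ∎

      bs-size : length bs + length bs ≤ length bs₁ + length bs₂
      bs-size = begin
        length bs + length bs                      ≡⟨ cong (length bs +_) (length-map (g ∙_) bs) ⟨
        length bs + length (map (g ∙_) bs)         ≤⟨ length-submodular unique-bs (map⁺ (∙-cancelˡ g _ _) unique-bs)
          (λ y∈ → inj₂ (to (bs₂⇔ _) (inj₁ y∈)))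
          (λ y∈ → inj₂ (to (bs₂⇔ _) (inj₂ y∈)))
          (λ y∈ y∈g → in-bs₁ bs₁⇔ y∈ (∈-map⁻ _ y∈g) , to (bs₂⇔ _) (inj₁ y∈)) ⟩
        length (map (g ∙_) bs₁) + length bs₂       ≡⟨ cong (_+ length bs₂) (length-map (g ∙_) bs₁) ⟩
        length bs₁ + length bs₂                    ∎

      -- Otherwise `Ag` lies in `A`, hence equals it and contains `ε`. But `x ∙ g ≡ ε` with `x` in
      -- `A` and `g` in `B` forces `x ≡ ε`, and so `g ≡ ε`.
      as<as₁ : length as < length as₁
      as<as₁ = ≰⇒> λ as₁≤as →
        let ag⊆as = λ {x} (x∈ag : x ∈ map (_∙ g) as) →
              ⊆∧length≥⇒⊇ unique-as (λ y∈ → pure (to (as₁⇔ _) (inj₁ y∈))) as₁≤as (to (as₁⇔ x) (inj₂ x∈ag))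
        in ⊆∧length≥⇒⊇ (map⁺ (∙-cancelʳ g _ _) unique-as) ag⊆as
             (≤-reflexive (sym (length-map (_∙ g) as))) ε∈as ε∉as∙g
    case length as + length bs ≤? length as₁ + length bs₁ of λ where
      (yes le) → pure (as₁ , bs₁ , U₁ , inj₁ (le , as<as₁))
      (no ≰)   → pure (as₂ , bs₂ , U₂ , inj₂ (average {length as} {length as₁} {length as₂} as-size bs-size (≰⇒> ≰)))
    where
    open UniquelyFactored U
    open Equivalence using (to; from)
    open ≤-Reasoning

    product₁ : ∀ {x y} → x ∈ as ⊎ x ∈ map (_∙ g) as → y ∈ bs × (g ∙ y) ∈ bs → (x ∙ y) ∈ cs
    product₁ (inj₁ x∈) (y∈ , _)  = as∙bs⊆cs x∈ y∈
    product₁ (inj₂ x∈) (_ , gy∈) with z , z∈ , refl ← ∈-map⁻ _ x∈ =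
      subst (_∈ cs) (sym (assoc _ _ _)) (as∙bs⊆cs z∈ gy∈)

    only-ε₁ : ∀ {x y} → x ∈ as ⊎ x ∈ map (_∙ g) as → y ∈ bs × (g ∙ y) ∈ bs → (x ∙ y) ≡ ε → x ≡ ε
    only-ε₁ (inj₁ x∈) (y∈ , _)   eq = only-ε x∈ y∈ eq
    -- Here `x` is `z ∙ g`. From `z ∙ (g ∙ y) ≡ ε` follows `z ≡ ε`, so `g ∙ y ≡ ε` with `g` in `as`
    -- and `y` in `bs`, which forces `g ≡ ε`.
    only-ε₁ {y = y} (inj₂ x∈) (y∈ , gy∈) eq with z , z∈ , refl ← ∈-map⁻ _ x∈ =
      contradiction (only-ε g∈as y∈ gy≡ε) g≢ε
      where
      z[gy]≡ε : (z ∙ (g ∙ y)) ≡ ε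
      z[gy]≡ε = trans (sym (assoc _ _ _)) eq

      gy≡ε : (g ∙ y) ≡ ε
      gy≡ε = trans (sym (identityˡ _)) (trans (cong (_∙ (g ∙ y)) (sym (only-ε z∈ gy∈ z[gy]≡ε))) z[gy]≡ε)

    product₂ : ∀ {x y} → x ∈ as × (x ∙ g) ∈ as → y ∈ bs ⊎ y ∈ map (g ∙_) bs → (x ∙ y) ∈ cs
    product₂ (x∈ , _) (inj₁ y∈)  = as∙bs⊆cs x∈ y∈
    product₂ (_ , xg∈) (inj₂ y∈) with z , z∈ , refl ← ∈-map⁻ _ y∈ =
      subst (_∈ cs) (assoc _ _ _) (as∙bs⊆cs xg∈ z∈)

    only-ε₂ : ∀ {x y} → x ∈ as × (x ∙ g) ∈ as → y ∈ bs ⊎ y ∈ map (g ∙_) bs → (x ∙ y) ≡ ε → x ≡ ε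
    only-ε₂ (x∈ , _)   (inj₁ y∈) eq = only-ε x∈ y∈ eq
    only-ε₂ (x∈ , xg∈) (inj₂ y∈) eq with z , z∈ , refl ← ∈-map⁻ _ y∈ =
      only-ε x∈ g∈bs (only-ε xg∈ z∈ (trans (assoc _ _ _) eq))

    in-as₂ : ∀ {as₂ y} → (∀ x → (x ∈ as × (x ∙ g) ∈ as) ⇔ x ∈ as₂) →
      y ∈ as → ∃[ x ] x ∈ as × y ≡ (x ∙ g) → y ∈ map (_∙ g) as₂
    in-as₂ as₂⇔ y∈ (x , x∈ , refl) = ∈-map⁺ _ (to (as₂⇔ x) (x∈ , y∈))

    in-bs₁ : ∀ {bs₁ y} → (∀ x → (x ∈ bs × (g ∙ x) ∈ bs) ⇔ x ∈ bs₁) →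
      y ∈ bs → ∃[ x ] x ∈ bs × y ≡ (g ∙ x) → y ∈ map (g ∙_) bs₁
    in-bs₁ bs₁⇔ y∈ (x , x∈ , refl) = ∈-map⁺ _ (to (bs₁⇔ x) (x∈ , y∈))

    ε∉as∙g : ε ∉ map (_∙ g) as
    ε∉as∙g ε∈ with x , x∈ , ε≡xg ← ∈-map⁻ _ ε∈ = g≢ε
      (trans (sym (identityˡ g)) (trans (cong (_∙ g) (sym (only-ε x∈ g∈bs (sym ε≡xg)))) (sym ε≡xg)))

    average : ∀ {α α₁ α₂ β β₁ β₂} → α + α ≤ α₁ + α₂ → β + β ≤ β₁ + β₂ → α₁ + β₁ < α + β → α + β < α₂ + β₂
    average {α} {α₁} {α₂} {β} {β₁} {β₂} α≤ β≤ 1< = ≰⇒> λ 2≤ → <⇒≱ (+-mono-<-≤ 1< 2≤) (begin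
      (α + β) + (α + β)       ≡⟨ +-interchange α β α β ⟩
      (α + α) + (β + β)       ≤⟨ +-mono-≤ α≤ β≤ ⟩
      (α₁ + α₂) + (β₁ + β₂)   ≡⟨ +-interchange α₁ α₂ β₁ β₂ ⟩
      (α₁ + β₁) + (α₂ + β₂)   ∎)

  scherk-step : ∀ {cs as bs} → UniquelyFactored cs as bs →
    (∀ {as′ bs′} → UniquelyFactored cs as′ bs′ → Progress as bs as′ bs′ →
      length as′ + length bs′ ≤ suc (length cs)) →
    length as + length bs ≤ suc (length cs)
  scherk-step {cs} {as} {bs} U rec = ≤-stable (¬¬-excluded-middle >>= λ where
    (no none) → pure (trivial none)
    (yes (g , g∈as , g∈bs , g≢ε)) → transform U g∈as g∈bs g≢ε >>= λ where
      (as′ , bs′ , U′ , pr) → pure (≤-trans ([ proj₁ , <⇒≤ ]′ pr) (rec U′ pr)))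
    where
    open UniquelyFactored U

    -- When `as` and `bs` share only `ε`, both lie in `cs` and overlap in a single point, which the
    -- singleton `t₁` accounts for.
    trivial : ¬ (∃[ g ] g ∈ as × g ∈ bs × g ≢ ε) → length as + length bs ≤ suc (length cs)
    trivial none = length-submodular-¬¬ {t₁ = ε ∷ []} unique-as unique-bs
      (λ y∈ → pure (inj₂ (as⊆cs y∈))) (λ y∈ → pure (inj₂ (bs⊆cs y∈)))
      (λ y∈as y∈bs k → none (_ , y∈as , y∈bs , λ y≡ε → k (here y≡ε , as⊆cs y∈as)))

  scherk-kemperman : ∀ {cs as bs} → UniquelyFactored cs as bs → length as + length bs ≤ suc (length cs)
  scherk-kemperman {cs} U = go (suc (N + N)) (suc N) U (m≤n+m _ _) (m≤n+m _ _)
    where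
    N = length cs

    -- d bounds how often ∣A∣ + ∣B∣ can still grow, e how often ∣A∣ can grow
    -- while ∣A∣ + ∣B∣ does not.
    go : ∀ d e {as bs} → UniquelyFactored cs as bs →
      N + N < length as + length bs + d → N < length as + e → length as + length bs ≤ suc N
    go zero e U d> e> = contradiction
      (+-mono-≤ (length-mono unique-as as⊆cs) (length-mono unique-bs bs⊆cs))
      (<⇒≱ (subst (N + N <_) (+-identityʳ _) d>))
      where open UniquelyFactored U
    go (suc d) zero U d> e> = contradiction (length-mono unique-as as⊆cs)
      (<⇒≱ (subst (N <_) (+-identityʳ _) e>))
      where open UniquelyFactored U
    go (suc d) (suc e) U d> e> = scherk-step U λ U′ →
      [ (λ (le , lt) → go (suc d) e U′
          (<-≤-trans d> (+-monoˡ-≤ _ le))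
          (≤-trans e> (≤-trans (≤-reflexive (+-suc _ e)) (+-monoˡ-≤ e lt))))
      -- When the total grows, `as` may shrink, so `e` is reset to `suc N`, which is enough for any
      -- `as`.
      , (λ lt → go d (suc N) U′
          (≤-trans d> (≤-trans (≤-reflexive (+-suc _ d)) (+-monoˡ-≤ d lt)))
          (m≤n+m _ _)) ]′

-- Finite transitive relations

-- Permutations are stored as tables so that equal permutations are
-- propositionally equal.

infixr 9 _⊚_
_⊚_ : ∀ {k} → Vec (Fin k) k → Vec (Fin k) k → Vec (Fin k) k
f ⊚ g = Vec.map (Vec.lookup f) g

lookup-⊚ : ∀ {k} (f g : Vec (Fin k) k) i → Vec.lookup (f ⊚ g) i ≡ Vec.lookup f (Vec.lookup g i)
lookup-⊚ f g i = Vec.lookup-map i (Vec.lookup f) g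

⊚-assoc : ∀ {k} (f g h : Vec (Fin k) k) → (f ⊚ g) ⊚ h ≡ f ⊚ (g ⊚ h)
⊚-assoc f g h = trans (Vec.map-cong (lookup-⊚ f g) h) (Vec.map-∘ (Vec.lookup f) (Vec.lookup g) h)

⊚-identityˡ : ∀ {k} (f : Vec (Fin k) k) → Vec.allFin k ⊚ f ≡ f
⊚-identityˡ f = trans (Vec.map-cong Vec.lookup-allFin f) (Vec.map-id f)

⊚-identityʳ : ∀ {k} (f : Vec (Fin k) k) → f ⊚ Vec.allFin k ≡ f
⊚-identityʳ = Vec.map-lookup-allFin

⊚-cancel : ∀ {k} (f g f′ g′ : Vec (Fin k) k) → f ⊚ f′ ≡ Vec.allFin k → g ⊚ g′ ≡ Vec.allFin k →
  (f ⊚ g) ⊚ (g′ ⊚ f′) ≡ Vec.allFin k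
⊚-cancel {k} f g f′ g′ ff′ gg′ = begin
  (f ⊚ g) ⊚ (g′ ⊚ f′)       ≡⟨ ⊚-assoc f g (g′ ⊚ f′) ⟩
  f ⊚ (g ⊚ (g′ ⊚ f′))       ≡⟨ cong (f ⊚_) (⊚-assoc g g′ f′) ⟨
  f ⊚ ((g ⊚ g′) ⊚ f′)       ≡⟨ cong (λ h → f ⊚ (h ⊚ f′)) gg′ ⟩
  f ⊚ (Vec.allFin k ⊚ f′)   ≡⟨ cong (f ⊚_) (⊚-identityˡ f′) ⟩
  f ⊚ f′                    ≡⟨ ff′ ⟩
  Vec.allFin k              ∎
  where open ≡-Reasoning

record Perm (k : ℕ) : Set where
  constructor perm
  field
    table inverse : Vec (Fin k) k
    inverseʳ      : table ⊚ inverse ≡ Vec.allFin k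
    inverseˡ      : inverse ⊚ table ≡ Vec.allFin k

open Perm

perm-≡ : ∀ {k} {f g : Perm k} → table f ≡ table g → inverse f ≡ inverse g → f ≡ g
perm-≡ {f = perm _ _ _ _} {perm _ _ _ _} refl refl = cong₂ (perm _ _) (uip _ _) (uip _ _)
  where
  uip : ∀ {x y : A} (p q : x ≡ y) → p ≡ q
  uip refl refl = refl

module _ {k : ℕ} where

  infixl 7 _∙_

  _∙_ : Perm k → Perm k → Perm k
  f ∙ g = record
    { table = table f ⊚ table g
    ; inverse = inverse g ⊚ inverse f
    ; inverseʳ = ⊚-cancel (table f) (table g) (inverse f) (inverse g) (inverseʳ f) (inverseʳ g)
    ; inverseˡ = ⊚-cancel (inverse g) (inverse f) (table g) (table f) (inverseˡ g) (inverseˡ f)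
    }

  ι : Perm k
  ι = perm (Vec.allFin k) (Vec.allFin k) (⊚-identityˡ _) (⊚-identityˡ _)

  _⁻¹ : Perm k → Perm k
  f ⁻¹ = perm (inverse f) (table f) (inverseˡ f) (inverseʳ f)

  perm-isGroup : IsGroup _≡_ _∙_ ι _⁻¹
  perm-isGroup = record
    { isMonoid = record
      { isSemigroup = record
        { isMagma = record { isEquivalence = isEquivalence ; ∙-cong = cong₂ _∙_ }
        ; assoc = λ f g h → perm-≡ (⊚-assoc (table f) (table g) (table h))
                                   (sym (⊚-assoc (inverse h) (inverse g) (inverse f)))
        }
      ; identity = (λ f → perm-≡ (⊚-identityˡ _) (⊚-identityʳ _))
                 , (λ f → perm-≡ (⊚-identityʳ _) (⊚-identityˡ _))
      }
    ; inverse = (λ f → perm-≡ (inverseˡ f) (inverseˡ f)) , (λ f → perm-≡ (inverseʳ f) (inverseʳ f))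
    ; ⁻¹-cong = cong _⁻¹
    }

  permGroup : Group _ _
  permGroup = record { isGroup = perm-isGroup }

  act : Perm k → Fin k → Fin k
  act f = Vec.lookup (table f)

  act-∙ : ∀ f g i → act (f ∙ g) i ≡ act f (act g i)
  act-∙ f g = lookup-⊚ (table f) (table g)

  act-ι : ∀ i → act ι i ≡ i
  act-ι = Vec.lookup-allFin

  act-inverseˡ : ∀ f i → act (f ⁻¹) (act f i) ≡ i
  act-inverseˡ f i = trans (sym (act-∙ (f ⁻¹) f i))
    (trans (cong (λ t → Vec.lookup t i) (inverseˡ f)) (act-ι i))

  toPerm : (f g : Fin k → Fin k) → (∀ i → f (g i) ≡ i) → (∀ i → g (f i) ≡ i) → Perm k
  toPerm f g fg gf = perm (Vec.tabulate f) (Vec.tabulate g) (composite f g fg) (composite g f gf)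
    where
    composite : (f g : Fin k → Fin k) → (∀ i → f (g i) ≡ i) → Vec.tabulate f ⊚ Vec.tabulate g ≡ Vec.allFin k
    composite f g fg = trans (sym (Vec.tabulate-∘ (Vec.lookup (Vec.tabulate f)) g))
      (Vec.tabulate-cong λ i → trans (Vec.lookup∘tabulate f (g i)) (fg i))

  private
    vectors : ∀ n → List (Vec (Fin k) n)
    vectors zero    = [] ∷ []
    vectors (suc n) = cartesianProductWith _∷_ (allFin k) (vectors n)

    ∈-vectors : ∀ {n} (xs : Vec (Fin k) n) → xs ∈ vectors n
    ∈-vectors []       = here refl
    ∈-vectors (x ∷ xs) = ∈-cartesianProductWith⁺ _∷_ (∈-allFin x) (∈-vectors xs)

    IsPerm? : ∀ (f g : Vec (Fin k) k) → Dec (f ⊚ g ≡ Vec.allFin k × g ⊚ f ≡ Vec.allFin k)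
    IsPerm? f g = Vec.≡-dec Fin._≟_ _ _ ×-dec Vec.≡-dec Fin._≟_ _ _

    permOf : Vec (Fin k) k × Vec (Fin k) k → Perm k
    permOf (f , g) with IsPerm? f g
    ... | yes (fg , gf) = perm f g fg gf
    -- The default `ι` is harmless: `perms` need only cover all permutations, and repetitions in it
    -- do not matter.
    ... | no _          = ι

    permOf-table : ∀ f → permOf (table f , inverse f) ≡ f
    permOf-table f with IsPerm? (table f) (inverse f)
    ... | yes _ = perm-≡ refl refl
    ... | no ¬p = contradiction (inverseʳ f , inverseˡ f) ¬p

  perms : List (Perm k)
  perms = map permOf (cartesianProduct (vectors k) (vectors k))

  ∈-perms : ∀ f → f ∈ perms
  ∈-perms f = subst (_∈ perms) (permOf-table f)
    (∈-map⁺ permOf (∈-cartesianProduct⁺ (∈-vectors (table f)) (∈-vectors (inverse f))))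

  -- Recording the inverse as well makes this class a subgroup, with `swap` as the passage to
  -- inverses.
  Preserves : Rel (Fin k) ℓ → Perm k → Set ℓ
  Preserves R f = (∀ {i j} → R i j → R (act f i) (act f j)) × (∀ {i j} → R i j → R (act (f ⁻¹) i) (act (f ⁻¹) j))

  module _ {R : Rel (Fin k) ℓ} where

    preserves-ι : Preserves R ι
    preserves-ι = fixed , fixed
      where
      fixed : ∀ {i j} → R i j → R (act ι i) (act ι j)
      fixed = subst₂ R (sym (act-ι _)) (sym (act-ι _))

    preserves-∙ : ∀ f g → Preserves R f → Preserves R g → Preserves R (f ∙ g)
    preserves-∙ f g (f⁺ , f⁻) (g⁺ , g⁻) =
      (subst₂ R (sym (act-∙ f g _)) (sym (act-∙ f g _)) ∘ f⁺ ∘ g⁺) ,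
      (subst₂ R (sym (act-∙ (g ⁻¹) (f ⁻¹) _)) (sym (act-∙ (g ⁻¹) (f ⁻¹) _)) ∘ g⁻ ∘ f⁻)

  -- Lift to the group of automorphisms g of R by g ↦ g v.  The fibres all have the
  -- size of the stabiliser of v, and keeping only ι of the fibre of R(v) over v
  -- makes the factorisation of ι unique.
  module _ (R : Rel (Fin k) ℓ) (R-refl : Reflexive R) (v : Fin k)
           (transitive : ∀ i → ∃[ f ] Preserves R f × act f v ≡ i) where

    private
      t : Fin k → Perm k
      t i = proj₁ (transitive i)

      module Cosets (hs : List (Perm k)) (hs-unique : Unique hs)
                    (hs⇔ : ∀ f → (Preserves R f × act f v ≡ v) ⇔ f ∈ hs) where

        open Equivalence using (to; from)
        open IsGroup perm-isGroup using (assoc; identityˡ)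
        open GroupProperties permGroup using (∙-cancelˡ)

        -- A left coset of the stabiliser `hs` of `v`: the automorphisms of `R` that carry `v` to
        -- `i`.
        coset : Fin k → List (Perm k)
        coset i = map (t i ∙_) hs

        cosets : List (Fin k) → List (Perm k)
        cosets = concatMap coset

        ∈-coset⁻ : ∀ {f i} → f ∈ coset i → Preserves R f × act f v ≡ i
        ∈-coset⁻ {i = i} f∈ with h , h∈ , refl ← ∈-map⁻ _ f∈ =
          let (Rt , tv≡i) = proj₂ (transitive i)
              (Rh , hv≡v) = from (hs⇔ h) h∈
          in preserves-∙ (t i) h Rt Rh , trans (act-∙ (t i) h v) (trans (cong (act (t i)) hv≡v) tv≡i)

        ∈-coset⁺ : ∀ {f} → Preserves R f → f ∈ coset (act f v)
        ∈-coset⁺ {f} Rf = subst (_∈ coset i) t∙t⁻¹∙f≡f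
          (∈-map⁺ _ (to (hs⇔ (t i ⁻¹ ∙ f)) (preserves-∙ (t i ⁻¹) f (swap Rt) Rf , fixes)))
          where
          i = act f v
          Rt = proj₁ (proj₂ (transitive i))

          t∙t⁻¹∙f≡f : t i ∙ (t i ⁻¹ ∙ f) ≡ f
          t∙t⁻¹∙f≡f = trans (sym (assoc (t i) (t i ⁻¹) f))
            (trans (cong (_∙ f) (IsGroup.inverseʳ perm-isGroup (t i))) (identityˡ f))

          fixes : act (t i ⁻¹ ∙ f) v ≡ v
          fixes = trans (act-∙ (t i ⁻¹) f v)
            (trans (cong (act (t i ⁻¹)) (sym (proj₂ (proj₂ (transitive i))))) (act-inverseˡ (t i) v))

        ∈-cosets⁻ : ∀ xs {f} → f ∈ cosets xs → Preserves R f × act f v ∈ xs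
        ∈-cosets⁻ xs f∈ with x , x∈xs , f∈x ← find (∈-concatMap⁻ coset {xs = xs} f∈)
                        with Rf , refl ← ∈-coset⁻ f∈x = Rf , x∈xs

        ∈-cosets⁺ : ∀ {xs f} → Preserves R f → act f v ∈ xs → f ∈ cosets xs
        ∈-cosets⁺ Rf fv∈xs = ∈-concatMap⁺ coset (lose fv∈xs (∈-coset⁺ Rf))

        cosets-unique : ∀ {xs} → Unique xs → Unique (cosets xs)
        cosets-unique []                     = []
        cosets-unique {x ∷ xs} u@(_ ∷ u′) = ++⁺ (map⁺ (∙-cancelˡ (t x) _ _) hs-unique) (cosets-unique u′)
          λ (f∈x , f∈xs) → head∉ u (subst (_∈ xs) (proj₂ (∈-coset⁻ f∈x)) (proj₂ (∈-cosets⁻ xs f∈xs)))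

        length-cosets : ∀ xs → length (cosets xs) ≡ length xs * length hs
        length-cosets []       = refl
        length-cosets (x ∷ xs) = trans (length-++ (coset x))
          (cong₂ _+_ (length-map (t x ∙_) hs) (length-cosets xs))

    finite-boundary : ∀ {fs rs cs} → Unique fs → Unique rs → v ∈ fs →
      (∀ {i} → i ∈ fs → R i v → i ≡ v) → (∀ {i} → i ∈ rs → R v i × i ≢ v) →
      (∀ {i j} → i ∈ fs → R i j → j ∈ cs) → length fs + length rs ≤ length cs
    finite-boundary {fs} {rs} {cs} ufs urs v∈fs fs∩R⁻v rs⊆Rv Rfs⊆cs = ≤-stable do
      (_ , hs , _ , uhs , hs⇔) ← covered⇒¬¬finite perms (λ f → Preserves R f × act f v ≡ v) (λ f _ → ∈-perms f)
      pure (bound hs uhs hs⇔)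
      where
      module _ (hs : List (Perm k)) (uhs : Unique hs)
               (hs⇔ : ∀ f → (Preserves R f × act f v ≡ v) ⇔ f ∈ hs) where
        open Cosets hs uhs hs⇔
        open IsGroup perm-isGroup using (identityʳ)

        factored : UniquelyFactored perm-isGroup (cosets cs) (cosets fs) (ι ∷ cosets rs)
        factored = record
          { unique-as = cosets-unique ufs
          ; unique-bs = unique-∷ (λ ι∈ → proj₂ (rs⊆Rv (proj₂ (∈-cosets⁻ rs ι∈))) (act-ι v)) (cosets-unique urs)
          ; ε∈as = ∈-cosets⁺ preserves-ι (subst (_∈ fs) (sym (act-ι v)) v∈fs)
          ; ε∈bs = here refl
          ; as∙bs⊆cs = product
          ; only-ε = only-ι
          }
          where
          product : ∀ {f g} → f ∈ cosets fs → g ∈ ι ∷ cosets rs → f ∙ g ∈ cosets cs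
          -- Reflexivity of `R` places `fs` inside `cs`.
          product {f} f∈ (here refl) with Rf , fv∈fs ← ∈-cosets⁻ fs f∈ =
            subst (_∈ cosets cs) (sym (identityʳ f)) (∈-cosets⁺ Rf (Rfs⊆cs fv∈fs R-refl))
          product {f} {g} f∈ (there g∈) with Rf , fv∈fs ← ∈-cosets⁻ fs f∈ | Rg , gv∈rs ← ∈-cosets⁻ rs g∈ =
            ∈-cosets⁺ (preserves-∙ f g Rf Rg)
              (subst (_∈ cs) (sym (act-∙ f g v)) (Rfs⊆cs fv∈fs (proj₁ Rf (proj₁ (rs⊆Rv gv∈rs)))))

          only-ι : ∀ {f g} → f ∈ cosets fs → g ∈ ι ∷ cosets rs → f ∙ g ≡ ι → f ≡ ι
          only-ι {f} f∈ (here refl) fι≡ι = trans (sym (identityʳ f)) fι≡ι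
          -- As `act g v` is in `R(v)`, applying `f` gives an edge from `act f v` to `v`. Thus
          -- `act f v` is in `fs` and in `R⁻(v)`, so it is `v`; then `act g v` is `v` too, which
          -- `rs` excludes.
          only-ι {f} {g} f∈ (there g∈) fg≡ι with Rf , fv∈fs ← ∈-cosets⁻ fs f∈ | Rg , gv∈rs ← ∈-cosets⁻ rs g∈ =
            contradiction gv≡v (proj₂ (rs⊆Rv gv∈rs))
            where
            fgv≡v : act f (act g v) ≡ v
            fgv≡v = trans (sym (act-∙ f g v)) (trans (cong (λ h → act h v) fg≡ι) (act-ι v))

            fv≡v : act f v ≡ v
            fv≡v = fs∩R⁻v fv∈fs (subst (R (act f v)) fgv≡v (proj₁ Rf (proj₁ (rs⊆Rv gv∈rs))))

            gv≡v : act g v ≡ v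
            gv≡v = trans (sym (act-inverseˡ f (act g v)))
              (trans (cong (act (f ⁻¹)) (trans fgv≡v (sym fv≡v))) (act-inverseˡ f v))

        bound : length fs + length rs ≤ length cs
        -- The extra entry `ι` cancels the `suc` in the Scherk-Kemperman bound, leaving a multiple
        -- of `length hs` on each side; `hs` is nonempty since it contains `ι`.
        bound = *-cancelʳ-≤ _ _ (length hs) ⦃ >-nonZero (∈-length ι∈hs) ⦄ (s≤s⁻¹ (begin
          suc ((length fs + length rs) * length hs)               ≡⟨ cong suc (*-distribʳ-+ (length hs) (length fs) _) ⟩
          suc (length fs * length hs + length rs * length hs)     ≡⟨ cong suc (cong₂ _+_ (length-cosets fs) (length-cosets rs)) ⟨
          suc (length (cosets fs) + length (cosets rs))           ≡⟨ +-suc (length (cosets fs)) _ ⟨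
          length (cosets fs) + suc (length (cosets rs))           ≤⟨ scherk-kemperman perm-isGroup factored ⟩
          suc (length (cosets cs))                                ≡⟨ cong suc (length-cosets cs) ⟩
          suc (length cs * length hs)                             ∎))
          where
          open ≤-Reasoning
          ι∈hs : ι ∈ hs
          ι∈hs = Equivalence.to (hs⇔ ι) (preserves-ι , act-ι v)

-- Atoms

lookup-injective : {xs : List A} → Unique xs → ∀ i j → List.lookup xs i ≡ List.lookup xs j → i ≡ j
lookup-injective u@(_ ∷ _) zero    zero    _  = refl
lookup-injective u@(_ ∷ _) zero    (suc j) eq = contradiction (subst (_∈ _) (sym eq) (∈-lookup j)) (head∉ u)
lookup-injective u@(_ ∷ _) (suc i) zero    eq = contradiction (subst (_∈ _) eq (∈-lookup i)) (head∉ u)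
lookup-injective (_ ∷ u)   (suc i) (suc j) eq = cong suc (lookup-injective u i j eq)

minimum : (P : ℕ → Set p) → ∃[ n ] P n → ¬ ¬ (∃[ n ] P n × (∀ m → P m → n ≤ m))
minimum P (n , Pn) none = <-rec (λ n → ¬ P n)
  (λ n ih Pn → none (n , Pn , λ m Pm → ≮⇒≥ λ m<n → ih m<n Pm)) n Pn

module _ {V : Set a} (Γ : Rel V ℓ) where

  module Auto {f : V → V} (auto : IsAutomorphism Γ f) where

    injective : ∀ {x y} → f x ≡ f y → x ≡ y
    injective = proj₁ (proj₁ auto)

    preimage : ∀ y → ∃[ x ] f x ≡ y
    preimage y = let (x , eq) = proj₂ (proj₁ auto) y in x , eq refl

    preserves : ∀ {x y} → Γ x y → Γ (f x) (f y)
    preserves {x} {y} xy with _ , refl , r ← proj₂ (proj₂ auto x) (y , (x , refl , xy) , refl) = r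

    reflects : ∀ {x y} → Γ (f x) (f y) → Γ x y
    reflects {x} r with proj₁ (proj₂ auto x) (_ , refl , r)
    ... | _ , (_ , refl , xz) , fz≡fy = subst (Γ x) (injective fz≡fy) xz

  -- `xs` may repeat entries, so `xs ++ ys` can serve as a union; only `ds` is counted.
  Boundary : List V → List V → Set _
  Boundary xs ds = Unique ds × (∀ y → (Γ ⟨ _∈ xs ⟩ ∖ (_∈ xs)) y ⇔ y ∈ ds)

  Nonempty : List V → Set _
  Nonempty xs = ∃[ x ] x ∈ xs

  module _ {xs ds : List V} (∂xs : Boundary xs ds) where

    ∂⁺ : ∀ {x y} → x ∈ xs → Γ x y → y ∉ xs → y ∈ ds
    ∂⁺ x∈xs xy y∉xs = Equivalence.to (proj₂ ∂xs _) ((_ , x∈xs , xy) , y∉xs)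

    ∂⁻ : ∀ {y} → y ∈ ds → (∃[ x ] x ∈ xs × Γ x y) × y ∉ xs
    ∂⁻ = Equivalence.from (proj₂ ∂xs _)

  -- No point is counted more often on the left than on the right. A boundary point of the
  -- intersection lies outside `xs` or outside `ys`, hence in that boundary; a point in both
  -- left-hand boundaries lies outside both sets and has an in-neighbour in both.
  boundary-submodular : ∀ {xs ys is dxs dys dis dus} → (∀ z → (z ∈ xs × z ∈ ys) ⇔ z ∈ is) →
    Boundary xs dxs → Boundary ys dys → Boundary is dis → Boundary (xs ++ ys) dus →
    length dis + length dus ≤ length dxs + length dys
  boundary-submodular {xs} {ys} {is} {dxs} {dys} {dis} {dus} is⇔ ∂xs ∂ys ∂is ∂us =
    length-submodular-¬¬ (proj₁ ∂is) (proj₁ ∂us) meet (pure ∘ join) (λ y∈dis y∈dus → pure (both y∈dis y∈dus))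
    where
    open Equivalence using (to; from)

    meet : ∀ {y} → y ∈ dis → ¬ ¬ (y ∈ dxs ⊎ y ∈ dys)
    meet {y} y∈ with (x , x∈is , xy) , y∉is ← ∂⁻ ∂is y∈ = ¬¬-excluded-middle >>= λ where
      (yes y∈xs) → pure (inj₂ (∂⁺ ∂ys (proj₂ (from (is⇔ x) x∈is)) xy λ y∈ys → y∉is (to (is⇔ y) (y∈xs , y∈ys))))
      (no y∉xs)  → pure (inj₁ (∂⁺ ∂xs (proj₁ (from (is⇔ x) x∈is)) xy y∉xs))

    join : ∀ {y} → y ∈ dus → y ∈ dxs ⊎ y ∈ dys
    join y∈ with (x , x∈us , xy) , y∉us ← ∂⁻ ∂us y∈ =
      Sum.map (λ x∈xs → ∂⁺ ∂xs x∈xs xy (y∉us ∘ ∈-++⁺ˡ)) (λ x∈ys → ∂⁺ ∂ys x∈ys xy (y∉us ∘ ∈-++⁺ʳ xs)) (∈-++⁻ xs x∈us)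

    both : ∀ {y} → y ∈ dis → y ∈ dus → y ∈ dxs × y ∈ dys
    both y∈dis y∈dus with (x , x∈is , xy) , _ ← ∂⁻ ∂is y∈dis | _ , y∉us ← ∂⁻ ∂us y∈dus =
      let (x∈xs , x∈ys) = from (is⇔ x) x∈is
      in ∂⁺ ∂xs x∈xs xy (y∉us ∘ ∈-++⁺ˡ) , ∂⁺ ∂ys x∈ys xy (y∉us ∘ ∈-++⁺ʳ xs)

  record Atom (as : List V) : Set (a ⊔ ℓ) where
    field
      unique   : Unique as
      nonempty : Nonempty as
      ds       : List V
      boundary : Boundary as ds
      least    : ∀ {xs dxs} → Nonempty xs → Boundary xs dxs → length ds ≤ length dxs
      smallest : ∀ {xs dxs} → Unique xs → Nonempty xs → Boundary xs dxs →
                 length dxs ≤ length ds → length as ≤ length xs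

  -- Minimality refers to `ds` and `as` only through their lengths, which `map f` keeps.
  atom-image : ∀ {f as} → IsAutomorphism Γ f → Atom as → Atom (map f as)
  atom-image {f} {as} auto atom = record
    { unique   = map⁺ injective unique
    ; nonempty = let (x , x∈as) = nonempty in f x , ∈-map⁺ f x∈as
    ; ds       = map f ds
    ; boundary = map⁺ injective (proj₁ boundary) , λ y → mk⇔ forth back
    ; least    = λ ne ∂xs → ≤-trans (≤-reflexive (length-map f ds)) (least ne ∂xs)
    ; smallest = λ u ne ∂xs le → ≤-trans (≤-reflexive (length-map f as))
        (smallest u ne ∂xs (≤-trans le (≤-reflexive (length-map f ds))))
    }
    where
    open Atom atom
    open Auto auto

    forth : ∀ {y} → (Γ ⟨ _∈ map f as ⟩ ∖ (_∈ map f as)) y → y ∈ map f ds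
    forth {y} ((_ , fx∈ , r) , y∉) with x , x∈as , refl ← ∈-map⁻ f fx∈ | z , refl ← preimage y =
      ∈-map⁺ f (∂⁺ boundary x∈as (reflects r) (y∉ ∘ ∈-map⁺ f))

    back : ∀ {y} → y ∈ map f ds → (Γ ⟨ _∈ map f as ⟩ ∖ (_∈ map f as)) y
    back y∈ with z , z∈ds , refl ← ∈-map⁻ f y∈ with (x , x∈as , xz) , z∉as ← ∂⁻ boundary z∈ds =
      (f x , ∈-map⁺ f x∈as , preserves xz) ,
      λ fz∈ → let (w , w∈as , fz≡fw) = ∈-map⁻ f fz∈ in z∉as (subst (_∈ as) (sym (injective fz≡fw)) w∈as)

  module _ (lf : LocallyFinite Γ) where

    boundary-exists : ∀ xs → ¬ ¬ (∃[ ds ] Boundary xs ds)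
    boundary-exists xs = do
      xs-finite ← covered⇒¬¬finite xs (_∈ xs) (λ _ → id)
      (_ , ds , _ , ∂xs) ← finite⇒¬¬finite-boundary Γ lf (_∈ xs) xs-finite
      pure (ds , ∂xs)

    atom-exists : V → ¬ ¬ (∃[ as ] Atom as)
    atom-exists v = do
      (ds₀ , ∂v) ← boundary-exists (v ∷ [])
      (κ , (xs , ds₁ , ne , ∂xs , refl) , κ-min) ← minimum
        (λ n → ∃[ xs ] ∃[ ds ] Nonempty xs × Boundary xs ds × length ds ≡ n)
        (_ , v ∷ [] , ds₀ , (v , here refl) , ∂v , refl)
      -- The second minimum ranges over duplicate-free lists, so `xs` is first stripped of
      -- repetitions, which does not enlarge its boundary. There `length ds ≤ κ` amounts to
      -- equality, by the choice of `κ`.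
      (_ , us , _ , uus , us⇔) ← covered⇒¬¬finite xs (_∈ xs) (λ _ → id)
      (dus , ∂us) ← boundary-exists us
      (α , (as , ds , u , ne′ , ∂as , le , refl) , α-min) ← minimum
        (λ n → ∃[ as ] ∃[ ds ] Unique as × Nonempty as × Boundary as ds × length ds ≤ κ × length as ≡ n)
        (_ , us , dus , uus , (_ , Equivalence.to (us⇔ _) (proj₂ ne)) , ∂us ,
          length-mono (proj₁ ∂us) (λ y∈ → let ((x , x∈us , xy) , y∉us) = ∂⁻ ∂us y∈ in
            ∂⁺ ∂xs (Equivalence.from (us⇔ x) x∈us) xy (y∉us ∘ Equivalence.to (us⇔ _))) ,
          refl)
      pure (as , record
        { unique = u ; nonempty = ne′ ; ds = ds ; boundary = ∂as
        ; least = λ ne ∂ → ≤-trans le (κ-min _ (_ , _ , ne , ∂ , refl))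
        ; smallest = λ u ne ∂ ≤ds → α-min _ (_ , _ , u , ne , ∂ , ≤-trans ≤ds le , refl) })

    -- By submodularity, since the union with `as` is nonempty and so has a boundary no smaller than
    -- that of the atom.
    atom-uncross : ∀ {as xs is dxs dis} → Atom as → (∀ z → (z ∈ xs × z ∈ as) ⇔ z ∈ is) →
      Boundary xs dxs → Boundary is dis → length dis ≤ length dxs
    atom-uncross {as} {xs} {dxs = dxs} {dis} atom is⇔ ∂xs ∂is = ≤-stable do
      (dus , ∂us) ← boundary-exists (xs ++ as)
      pure (+-cancelʳ-≤ (length ds) _ _ (begin
        length dis + length ds   ≤⟨ +-monoʳ-≤ (length dis) (least (_ , ∈-++⁺ʳ xs (proj₂ nonempty)) ∂us) ⟩
        length dis + length dus  ≤⟨ boundary-submodular is⇔ ∂xs boundary ∂is ∂us ⟩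
        length dxs + length ds   ∎))
      where
      open Atom atom
      open ≤-Reasoning

    -- Uncrossing with `bs` shows that the boundary of the intersection is no larger than that of
    -- `as`. As `as` is smallest, the intersection is all of `as`.
    atoms-meet⇒⊆ : ∀ {as bs x} → Atom as → Atom bs → x ∈ as → x ∈ bs → ∀ {z} → z ∈ as → ¬ ¬ (z ∈ bs)
    atoms-meet⇒⊆ {as} {bs} {x} atom-as atom-bs x∈as x∈bs z∈as = do
      (_ , is , _ , uis , is⇔) ← covered⇒¬¬finite as (λ z → z ∈ as × z ∈ bs) (λ _ → proj₁)
      (dis , ∂is) ← boundary-exists is
      let as≤is = smallest uis (x , Equivalence.to (is⇔ x) (x∈as , x∈bs)) ∂is
                    (atom-uncross atom-bs is⇔ boundary ∂is)
      z∈is ← ⊆∧length≥⇒⊇ uis (λ y∈is → pure (proj₁ (Equivalence.from (is⇔ _) y∈is))) as≤is z∈as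
      pure (proj₂ (Equivalence.from (is⇔ _) z∈is))
      where open Atom atom-as

  -- Reduction to the relation induced on an atom.

  StabilisingAutomorphism : List V → V → V → Set _
  StabilisingAutomorphism as v j =
    ∃[ f ] IsAutomorphism Γ f × f v ≡ j × (∀ {z} → z ∈ as → f z ∈ as) × (∀ {z} → z ∈ as → z ∈ map f as)

  module _ (Γ-refl : Reflexive Γ) {as is ms dis : List V} {v : V}
           (as-unique : Unique as) (v∈as : v ∈ as)
           (stabilising : ∀ {j} → j ∈ as → StabilisingAutomorphism as v j)
           (is-unique : Unique is) (v∈is : v ∈ is) (is⊆as : ∀ {z} → z ∈ is → z ∈ as)
           (is∩Γ⁻v : ∀ {z} → z ∈ is → Γ z v → z ≡ v)
           (ms-unique : Unique ms) (ms⇔ : ∀ {y} → Γ v y ⇔ y ∈ ms) (∂is : Boundary is dis) where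

    private
      open Equivalence using (to; from)

      k = length as

      e : Fin k → V
      e = List.lookup as

      e-injective : ∀ {i j} → e i ≡ e j → i ≡ j
      e-injective = lookup-injective as-unique _ _

      v̂ : Fin k
      v̂ = Any.index v∈as

      ev̂≡v : e v̂ ≡ v
      ev̂≡v = sym (lookup-index v∈as)

      R : Rel (Fin k) ℓ
      R i j = Γ (e i) (e j)

      transitive : ∀ i → ∃[ g ] Preserves R g × act g v̂ ≡ i
      transitive i with f , auto , fv≡ , stable , onto ← stabilising (∈-lookup {xs = as} i) =
        toPerm φ ψ φψ ψφ ,
        ((λ r → subst₂ Γ (sym (e-φ _)) (sym (e-φ _)) (preserves r)) ,
         (λ r → reflects (subst₂ Γ (sym (f-ψ _)) (sym (f-ψ _)) r))) ,
        e-injective (trans (e-φ v̂) (trans (cong f ev̂≡v) fv≡))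
        where
        open Auto auto

        φ ψ : Fin k → Fin k
        φ j = Any.index (stable (∈-lookup j))
        ψ j = Any.index (proj₁ (proj₂ (∈-map⁻ f (onto (∈-lookup j)))))

        eφ : ∀ j → e (φ j) ≡ f (e j)
        eφ j = sym (lookup-index (stable (∈-lookup j)))

        fψ : ∀ j → f (e (ψ j)) ≡ e j
        fψ j = let (_ , z∈as , ej≡fz) = ∈-map⁻ f (onto (∈-lookup j))
               in trans (cong f (sym (lookup-index z∈as))) (sym ej≡fz)

        φψ : ∀ j → φ (ψ j) ≡ j
        φψ j = e-injective (trans (eφ (ψ j)) (fψ j))

        ψφ : ∀ j → ψ (φ j) ≡ j
        ψφ j = e-injective (injective (trans (fψ (φ j)) (eφ j)))

        e-φ : ∀ j → e (act (toPerm φ ψ φψ ψφ) j) ≡ f (e j)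
        e-φ j = trans (cong e (Vec.lookup∘tabulate φ j)) (eφ j)

        f-ψ : ∀ j → f (e (act (toPerm φ ψ φψ ψφ ⁻¹) j)) ≡ e j
        f-ψ j = trans (cong (f ∘ e) (Vec.lookup∘tabulate ψ j)) (fψ j)

    -- `Γ(v)` consists of `v`, the rest `rs` of its part in `as`, and its part `ws` outside `as`.
    -- The finite theorem bounds `rs` through `cs`, the part of `Γ(is)` in `as`; and `cs` and `ws`
    -- are disjoint subsets of the union of `is` and its boundary.
    block-boundary : length ms ≤ suc (length dis)
    block-boundary = ≤-stable do
      (_ , fs , _ , ufs , fs⇔) ← covered⇒¬¬finite (allFin k) (λ i → e i ∈ is) (λ i _ → ∈-allFin i)
      (_ , rs , _ , urs , rs⇔) ← covered⇒¬¬finite (allFin k) (λ i → R v̂ i × i ≢ v̂) (λ i _ → ∈-allFin i)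
      (_ , cs , _ , ucs , cs⇔) ← covered⇒¬¬finite (allFin k) (λ j → ∃[ i ] e i ∈ is × R i j) (λ j _ → ∈-allFin j)
      (_ , ws , _ , uws , ws⇔) ← covered⇒¬¬finite ms (λ y → Γ v y × y ∉ as) (λ _ (vy , _) → to ms⇔ vy)
      let
        inside : length fs + length rs ≤ length cs
        inside = finite-boundary R Γ-refl v̂ transitive ufs urs
          (to (fs⇔ v̂) (subst (_∈ is) (sym ev̂≡v) v∈is))
          (λ {i} i∈fs r → e-injective (trans (is∩Γ⁻v (from (fs⇔ i) i∈fs) (subst (Γ (e i)) ev̂≡v r)) (sym ev̂≡v)))
          (λ {i} → from (rs⇔ i))
          (λ {i} {j} i∈fs r → to (cs⇔ j) (i , from (fs⇔ i) i∈fs , r))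

        is≤fs : length is ≤ length fs
        is≤fs = ≤-trans (length-mono is-unique λ {z} z∈is →
            let p = is⊆as z∈is ; z≡e = lookup-index p
            in subst (_∈ map e fs) (sym z≡e) (∈-map⁺ e (to (fs⇔ (Any.index p)) (subst (_∈ is) z≡e z∈is))))
          (≤-reflexive (length-map e fs))

        ms≤ : length ms ≤ suc (length rs + length ws)
        ms≤ = ≤-trans (length-mono-¬¬ ms-unique λ {y} y∈ms → ¬¬-excluded-middle >>= λ where
            (no y∉as) → pure (there (∈-++⁺ʳ (map e rs) (to (ws⇔ y) (from ms⇔ y∈ms , y∉as))))
            (yes y∈as) → let j = Any.index y∈as ; y≡ej = lookup-index y∈as in case j Fin.≟ v̂ of λ where
              (yes j≡v̂) → pure (here (trans y≡ej (trans (cong e j≡v̂) ev̂≡v)))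
              (no j≢v̂)  → pure (there (∈-++⁺ˡ (subst (_∈ map e rs) (sym y≡ej) (∈-map⁺ e
                (to (rs⇔ j) (subst₂ Γ (sym ev̂≡v) y≡ej (from ms⇔ y∈ms) , j≢v̂)))))))
          (≤-reflexive (cong suc (trans (length-++ (map e rs)) (cong (_+ length ws) (length-map e rs)))))

        cs+ws≤ : length cs + length ws ≤ length is + length dis
        cs+ws≤ = ≤-trans (≤-reflexive (cong (_+ length ws) (sym (length-map e cs))))
          (length-submodular-¬¬ (map⁺ e-injective ucs) uws
            (λ {y} y∈ → case ∈-map⁻ e y∈ of λ where
              (j , j∈cs , refl) → ¬¬-excluded-middle >>= λ where
                (yes ej∈is) → pure (inj₁ ej∈is)
                (no ej∉is)  → let (i , ei∈is , r) = from (cs⇔ j) j∈cs in pure (inj₂ (∂⁺ ∂is ei∈is r ej∉is)))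
            (λ {y} y∈ → let (vy , y∉as) = from (ws⇔ y) y∈ in pure (inj₂ (∂⁺ ∂is v∈is vy (y∉as ∘ is⊆as))))
            (λ {y} y∈e y∈ws → case ∈-map⁻ e y∈e of λ where
              (j , _ , refl) → contradiction (∈-lookup j) (proj₂ (from (ws⇔ y) y∈ws))))
      pure (+-cancelˡ-≤ (length is) _ _ (begin
        length is + length ms                          ≤⟨ +-mono-≤ is≤fs ms≤ ⟩
        length fs + suc (length rs + length ws)        ≡⟨ +-suc (length fs) _ ⟩
        suc (length fs + (length rs + length ws))      ≡⟨ cong suc (+-assoc (length fs) _ _) ⟨
        suc (length fs + length rs + length ws)        ≤⟨ s≤s (+-monoˡ-≤ (length ws) inside) ⟩
        suc (length cs + length ws)                    ≤⟨ s≤s cs+ws≤ ⟩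
        suc (length is + length dis)                   ≡⟨ +-suc (length is) _ ⟨
        length is + suc (length dis)                   ∎))
      where open ≤-Reasoning

-- Finite sets.

finite-case : {V : Set a} (Γ : Rel V ℓ) → PointTransitive Γ → Reflexive Γ → LocallyFinite Γ →
  (v : V) (F : Pred V p) → F ∩ Γ ⁻[ v ] ≐ ｛ v ｝ →
  Finite F → ∀ (m n : ℕ) → ∣ Γ [ v ] ∣≡ m → ∣ Γ ⟨ F ⟩ ∖ F ∣≡ n → n ≥ m ∸ 1
finite-case {V = V} Γ tr Γ-refl lf v F (F∩⊆ , F∩⊇) (_ , fs , _ , ufs , fs⇔) _ _
    (ms , refl , ums , ms⇔) (ds , refl , uds , ds⇔) = ≤-stable do
  (as₀ , atom₀) ← atom-exists Γ lf v
  let (x , x∈as₀) = Atom.nonempty atom₀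
      (f , auto , fx≡v) = tr x v
      as = map f as₀
      v∈as : v ∈ as
      v∈as = subst (_∈ as) fx≡v (∈-map⁺ f x∈as₀)
      atom : Atom Γ as
      atom = atom-image Γ auto atom₀
  (_ , is , _ , uis , is⇔) ← covered⇒¬¬finite fs (λ z → z ∈ fs × z ∈ as) (λ _ → proj₁)
  (dis , ∂is) ← boundary-exists Γ lf is
  stabilising ← ¬¬-∀∈ as λ {j} j∈as → stabiliser atom v∈as j∈as
  let
    is⁻ : ∀ {z} → z ∈ is → z ∈ fs × z ∈ as
    is⁻ = from (is⇔ _)

    ms≤ : length ms ≤ suc (length dis)
    ms≤ = block-boundary Γ Γ-refl (Atom.unique atom) v∈as stabilising uis
      (to (is⇔ v) (to (fs⇔ v) v∈F , v∈as)) (proj₂ ∘ is⁻)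
      (λ z∈is zv → sym (F∩⊆ (from (fs⇔ _) (proj₁ (is⁻ z∈is)) , v , refl , zv)))
      ums (mk⇔ (λ vy → to (ms⇔ _) (v , refl , vy)) (λ y∈ms → out (from (ms⇔ _) y∈ms))) ∂is

    dis≤ : length dis ≤ length ds
    dis≤ = atom-uncross Γ lf atom is⇔ ∂fs ∂is
  pure (m≤n+o⇒m∸n≤o _ 1 (≤-trans ms≤ (s≤s dis≤)))
  where
  open Equivalence using (to; from)

  v∈F : F v
  v∈F = proj₁ (F∩⊇ refl)

  out : ∀ {y} → (Γ [ v ]) y → Γ v y
  out (_ , refl , vy) = vy

  ∂fs : Boundary Γ fs ds
  ∂fs = uds , λ y → mk⇔
    (λ ((x , x∈fs , xy) , y∉fs) → to (ds⇔ y) ((x , from (fs⇔ x) x∈fs , xy) , y∉fs ∘ to (fs⇔ y)))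
    (λ y∈ds → let ((x , x∈F , xy) , y∉F) = from (ds⇔ y) y∈ds in
      (x , to (fs⇔ x) x∈F , xy) , y∉F ∘ from (fs⇔ y))

  -- Every automorphism `f` taking `v` to `j` qualifies: the atoms `map f as` and `as` both contain
  -- `j`, so they coincide.
  stabiliser : ∀ {as j} → Atom Γ as → v ∈ as → j ∈ as → ¬ ¬ StabilisingAutomorphism Γ as v j
  stabiliser {as} {j} atom v∈as j∈as = do
    let (f , auto , fv≡j) = tr v j
        atom-f = atom-image Γ auto atom
        j∈fas : j ∈ map f as
        j∈fas = subst (_∈ map f as) fv≡j (∈-map⁺ f v∈as)
    stable ← ¬¬-∀∈ as λ z∈as → atoms-meet⇒⊆ Γ lf atom-f atom j∈fas j∈as (∈-map⁺ f z∈as)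
    onto   ← ¬¬-∀∈ as (atoms-meet⇒⊆ Γ lf atom atom-f j∈as j∈fas)
    pure (f , auto , fv≡j , (λ {_} → stable) , λ {_} → onto)

-- Cofinite sets, by reversal.

-- `IsAutomorphism` speaks of out-neighbours only; for a bijection this amounts to preserving and
-- reflecting edges, a condition symmetric under reversal.
flip-automorphism : {V : Set a} (Γ : Rel V ℓ) {f : V → V} → IsAutomorphism Γ f → IsAutomorphism (flip Γ) f
flip-automorphism Γ {f} auto = proj₁ auto , λ x →
  (λ { {y} (_ , refl , r) → let (z , fz≡y) = preimage y in
       z , (x , refl , reflects (subst (λ w → Γ w (f x)) (sym fz≡y) r)) , fz≡y }) ,
  (λ { (z , (_ , refl , zx) , refl) → f x , refl , preserves zx })
  where open Auto Γ auto

cofinite-case : {V : Set a} (Γ : Rel V ℓ) → PointTransitive Γ → Reflexive Γ → LocallyFinite Γ →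
  (v : V) (F : Pred V p) → F ∩ Γ ⁻[ v ] ≐ ｛ v ｝ →
  Cofinite F → ∀ (m n : ℕ) → ∣ Γ ⁻[ v ] ∣≡ m → ∣ Γ ⟨ F ⟩ ∖ F ∣≡ n → n ≥ m ∸ 1
cofinite-case {V = V} Γ tr Γ-refl lf v F (F∩⊆ , F∩⊇) (_ , cs , _ , _ , cs⇔) m _ mΓ⁻ (ds , refl , _ , ds⇔) = ≤-stable do
  -- By reflexivity `F` lies in `Γ(F)`, so the complement of `Γ(F)` is covered by the finite
  -- complement of `F`.
  G-finite ← covered⇒¬¬finite (v ∷ cs) G λ where
    y (inj₁ y≡v) → here y≡v
    y (inj₂ y∉ΓF) → there (to (cs⇔ y) λ y∈F → y∉ΓF (y , y∈F , Γ-refl))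
  (n , ∂G@(gs , |gs|≡n , ugs , gs⇔)) ← finite⇒¬¬finite-boundary (flip Γ) (swap ∘ lf) G G-finite
  let bound = finite-case (flip Γ) (λ x y → Product.map₂ (Product.map₁ (flip-automorphism Γ)) (tr x y))
        Γ-refl (swap ∘ lf) v G
        -- `G` meets `Γ(v)` in `v` alone: `v` is in `F`, so all of `Γ(v)` lies in `Γ(F)`.
        ( (λ { (inj₁ y≡v , _) → sym y≡v ; (inj₂ y∉ΓF , _ , refl , vy) → contradiction (v , v∈F , vy) y∉ΓF })
        , (λ { refl → inj₁ refl , v , refl , Γ-refl }))
        G-finite m n mΓ⁻ ∂G
  pure (≤-trans bound (≤-trans (≤-reflexive (sym |gs|≡n)) (length-mono-¬¬ ugs λ {y} y∈gs →
    ∂G⊆∂F (from (gs⇔ y) y∈gs) >>= λ y∈∂F → pure (to (ds⇔ y) y∈∂F))))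
  where
  open Equivalence using (to; from)

  v∈F : F v
  v∈F = proj₁ (F∩⊇ refl)

  G : Pred V _
  G y = y ≡ v ⊎ ¬ (Γ ⟨ F ⟩) y

  -- A point `y` outside `G` lies in `Γ(F)`, up to double negation. It is not in `F`: an edge from
  -- `F` cannot end outside `Γ(F)`, and one that ends at `v` starts at `v`, which is in `G`.
  ∂G⊆∂F : ∀ {y} → (flip Γ ⟨ G ⟩ ∖ G) y → ¬ ¬ (Γ ⟨ F ⟩ ∖ F) y
  ∂G⊆∂F {y} ((g , g∈G , yg) , y∉G) k = y∉G (inj₂ λ y∈ΓF → k (y∈ΓF , y∉F g∈G))
    where
    y∉F : G g → ¬ F y
    y∉F (inj₁ refl)  y∈F = y∉G (inj₁ (sym (F∩⊆ (y∈F , v , refl , yg))))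
    y∉F (inj₂ g∉ΓF) y∈F = g∉ΓF (y , y∈F , yg)

theorem5p1 : {a ℓ p : Level} {V : Set a} (Γ : Rel V ℓ) →
    PointTransitive Γ → Reflexive Γ → LocallyFinite Γ →
    (v : V) (F : Pred V p) → F ∩ Γ ⁻[ v ] ≐ ｛ v ｝ →
    (Finite F → ∀ (m n : ℕ) → ∣ Γ [ v ] ∣≡ m → ∣ Γ ⟨ F ⟩ ∖ F ∣≡ n → n ≥ m ∸ 1)
    × (Cofinite F → ∀ (m n : ℕ) → ∣ Γ ⁻[ v ] ∣≡ m → ∣ Γ ⟨ F ⟩ ∖ F ∣≡ n → n ≥ m ∸ 1)
theorem5p1 Γ tr Γ-refl lf v F F∩ = finite-case Γ tr Γ-refl lf v F F∩ , cofinite-case Γ tr Γ-refl lf v F F∩
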